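{- Suppose $\Omega\subseteq\Xi$ is closed under variable substitution. Then the relation $\perp^{\Omega}$ satisfies invariance, monotonicity, base monotonicity and finite character. In fact, $\perp^{\Omega}$ has strong finite character. Moreover, $A\perp^{\Omega}_BB$ and $A\perp^{\Omega}_AB$ hold for any sets $A$ and $B$.
   Context: $T$ is a complete consistent first-order theory (possibly many-sorted); we work in a big saturated model of $T$. All sets are small subsets of the big model; $BC$ means $B\cup C$. A tuple also denotes the set of its entries, and $\bar a\in A$ means that all entries of $\bar a$ lie in $A$. $(A,B,C)\equiv(A',B',C')$ means that some automorphism of the big model maps $A$ onto $A'$, $B$ onto $B'$ and $C$ onto $C'$. Writing a formula as $\varphi(\bar x)$ means that each of its free variables appears in $\bar x$. Inconsistency pairs. For a formula $\varphi(\bar x;\bar y)$ whose free variables are partitioned into two blocks, a formula $\psi(\bar y_0,\dots,\bar y_{k-1})$ (also written $\psi(\bar y_{<k})$; no parameters) is a $k$-inconsistency witness for $\varphi(\bar x;\bar y)$ if $\big(\bigwedge_{i<k}\varphi(\bar x;\bar y_i)\big)\wedge\psi(\bar y_{<k})$ is inconsistent. $\Xi$ is the set of all pairs $(\varphi(\bar x;\bar y),\psi(\bar y_{<k}))$, $k<\omega$, such that $\psi$ is a $k$-inconsistency witness for $\varphi$. Dividing. For $(\varphi,\psi)\in\Xi$, a formula $\varphi(\bar x;\bar b)$ $(\varphi,\psi)$-divides over a set $C$ if there is a sequence $(\bar b_i)_{i<\omega}$ such that each $\bar b_i$ realises $\operatorname{tp}(\bar b/C)$ and $\models\psi(\bar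 b_{i_0},\dots,\bar b_{i_{k-1}})$ for all $i_0<\dots<i_{k-1}<\omega$. A partial type $p(\bar x)$ $(\varphi,\psi)$-divides over $C$ if it contains a formula $\varphi(\bar x;\bar b)$ that $(\varphi,\psi)$-divides over $C$. A set $\Omega\subseteq\Xi$ is closed under variable substitution if whenever $(\varphi(\bar x;\bar y),\psi(\bar y_{<k}))\in\Omega$ and $\bar u,\bar v,\bar v_0,\dots,\bar v_{k-1}$ are tuples of variables of appropriate lengths and sorts (possibly with repetitions inside a tuple, but pairwise disjoint from each other), then $(\varphi(\bar u;\bar v),\psi(\bar v_{<k}))\in\Omega$. A partial type $\Omega$-divides over $C$ if it $(\varphi,\psi)$-divides over $C$ for some $(\varphi,\psi)\in\Omega$. Define $$A\perp^{\Omega}_CB\iff\text{there is no } \bar a\in A \text{ such that } \operatorname{tp}(\bar a/BC)\ \Omega\text{ -divides over } C.$$ Properties of a ternary relation $\perp$: - (invariance) If $A\perp_CB$ and $(A',B',C')\equiv(A,B,C)$, then $A'\perp_{C'}B'$. - (monotonicity) If $A\perp_CB$, $A'\subseteq A$ and $B'\subseteq B$, then $A'\perp_CB'$. - (base monotonicity) If $D\subseteq C\subseteq B$ and $A\perp_DB$, then $A\perp_CB$. - (finite character) If $A_0\perp_CB$ for all finite $A_0\subseteq A$, then $A\perp_CB$. - (strong finite character) If $A\not\perp_CB$, then there are finite tuples $\bar a\in A$, $\bar b\in B$, $\bar c\in C$ and a formula $\varphi(\bar x,\bar y,\bar z)$ without parameters such that $\models\varphi(\bar a,\bar b,\bar c)$,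 and $\bar a'\not\perp_C\bar b$ for all $\bar a'$ satisfying $\models\varphi(\bar a',\bar b,\bar c)$. -}

module Defs where

open import Level using (Level) renaming (suc to lsuc)
open import Data.Empty.Polymorphic using (⊥)
open import Data.Fin.Base as Fin using (Fin)
open import Data.List.Base using (List; []; _∷_; _++_; map; concat; replicate)
open import Data.List.Membership.Propositional using (_∈_)
open import Data.List.Membership.Propositional.Properties using (∈-++⁺ˡ; ∈-++⁺ʳ)
open import Data.List.Relation.Unary.All as All using (All; []; _∷_)
import Data.List.Relation.Unary.All.Properties as Allₚ
open import Data.List.Relation.Unary.Any using (here; there)
open import Data.Nat.Base using (ℕ; zero; suc; _<_)
open import Data.Product.Base using (Σ; ∃; ∃-syntax; Σ-syntax; _×_; _,_)
open import Data.Sum.Base using (_⊎_)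
open import Function.Base using (_∘_)
open import Function.Bundles using (_⇔_; _↔_; _↣_; Inverse; Injection)
open import Relation.Binary.PropositionalEquality.Core using (_≡_; refl)
open import Relation.Nullary.Negation.Core using (¬_)
import Relation.Unary as U
open U using (Pred; _⊆_; _∪_; _≐_)

private variable
  ℓ : Level

record Signature (ℓ : Level) : Set (lsuc ℓ) where
  field
    Sort   : Set ℓ
    Fun    : Set ℓ
    dom    : Fun → List Sort
    cod    : Fun → Sort
    Rel    : Set ℓ
    arity  : Rel → List Sort

module Syntax (L : Signature ℓ) where
  open Signature L

  -- A context is a finite tuple of distinct variables, given by their sorts;
  -- s ∈ Γ is the type of variables of sort s in Γ.
  Ctx : Set ℓ
  Ctx = List Sort

  data Term (Γ : Ctx) : Sort → Set ℓ where
    var : ∀ {s} → s ∈ Γ → Term Γ s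
    app : (f : Fun) → All (Term Γ) (dom f) → Term Γ (cod f)

  -- Formula Γ: formulas all of whose free variables appear in Γ.
  -- The remaining connectives are definable, the metatheory being classical.
  data Formula (Γ : Ctx) : Set ℓ where
    ⊥̇   : Formula Γ
    _≈̇_ : ∀ {s} → Term Γ s → Term Γ s → Formula Γ
    rel : (R : Rel) → All (Term Γ) (arity R) → Formula Γ
    ¬̇_  : Formula Γ → Formula Γ
    _∧̇_ : Formula Γ → Formula Γ → Formula Γ
    ∃̇   : (s : Sort) → Formula (s ∷ Γ) → Formula Γ

  Sentence : Set ℓ
  Sentence = Formula []

  -- Vars Γ Γ′: tuples of variables from Γ′, matching Γ in length and sorts,
  -- possibly with repetitions.
  Vars : Ctx → Ctx → Set ℓ
  Vars Γ Γ′ = All (_∈ Γ′) Γ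

  Exhausts : ∀ {Γ Γ′} → Vars Γ Γ′ → Set ℓ
  Exhausts {Γ} {Γ′} u = ∀ {s} (x : s ∈ Γ′) → Σ[ i ∈ s ∈ Γ ] All.lookup u i ≡ x

  lift : ∀ {Γ Γ′ s} → Vars Γ Γ′ → Vars (s ∷ Γ) (s ∷ Γ′)
  lift u = here refl ∷ All.map there u

  mutual
    renameTerm : ∀ {Γ Γ′ s} → Vars Γ Γ′ → Term Γ s → Term Γ′ s
    renameTerm u (var x)    = var (All.lookup u x)
    renameTerm u (app f ts) = app f (renameTerms u ts)

    renameTerms : ∀ {Γ Γ′ ss} → Vars Γ Γ′ → All (Term Γ) ss → All (Term Γ′) ss
    renameTerms u []       = []
    renameTerms u (t ∷ ts) = renameTerm u t ∷ renameTerms u ts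

  rename : ∀ {Γ Γ′} → Vars Γ Γ′ → Formula Γ → Formula Γ′
  rename u ⊥̇          = ⊥̇
  rename u (t ≈̇ t′)   = renameTerm u t ≈̇ renameTerm u t′
  rename u (rel R ts) = rel R (renameTerms u ts)
  rename u (¬̇ φ)      = ¬̇ rename u φ
  rename u (φ ∧̇ ψ)    = rename u φ ∧̇ rename u ψ
  rename u (∃̇ s φ)    = ∃̇ s (rename (lift u) φ)

  -- The concatenation of disjoint copies ȳ₀, …, ȳₖ₋₁ of the block ȳ.
  copies : ℕ → Ctx → Ctx
  copies k Δ = concat (replicate k Δ)

  _⊕_ : ∀ {Γ Γ′ Δ Δ′} → Vars Γ Γ′ → Vars Δ Δ′ → Vars (Γ ++ Δ) (Γ′ ++ Δ′)
  _⊕_ {Γ′ = Γ′} u v = Allₚ.++⁺ (All.map ∈-++⁺ˡ u) (All.map (∈-++⁺ʳ Γ′) v)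

  copiesVars : ∀ {Δ Δ′} k → Vars Δ Δ′ → Vars (copies k Δ) (copies k Δ′)
  copiesVars zero    v = []
  copiesVars (suc k) v = v ⊕ copiesVars k v

  -- The pairs (φ(x̄;ȳ), ψ(ȳ₀,…,ȳₖ₋₁)) with x̄ of sorts Γ and ȳ of sorts Δ;
  -- ψ is not yet required to be an inconsistency witness.
  record Pair (Γ Δ : Ctx) : Set ℓ where
    constructor pair
    field
      {k} : ℕ
      φ   : Formula (Γ ++ Δ)
      ψ   : Formula (copies k Δ)

  PairSet : (a : Level) → Set _
  PairSet a = ∀ {Γ Δ} → Pred (Pair Γ Δ) a

  -- (φ(ū;v̄), ψ(v̄₀,…,v̄ₖ₋₁)), where v̄ᵢ is the copy of v̄ in the i-th block.
  substPair : ∀ {Γ Γ′ Δ Δ′} → Vars Γ Γ′ → Vars Δ Δ′ → Pair Γ Δ → Pair Γ′ Δ′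
  substPair u v (pair {k} φ ψ) = pair {k = k} (rename (u ⊕ v) φ) (rename (copiesVars k v) ψ)

  -- The blocks of φ(ū;v̄) consist of the variables listed in ū and in v̄,
  -- whence Exhausts; closure under adding dummy variables is not demanded.
  ClosedUnderVariableSubstitution : PairSet ℓ → Set ℓ
  ClosedUnderVariableSubstitution Ω =
    ∀ {Γ Γ′ Δ Δ′} (u : Vars Γ Γ′) (v : Vars Δ Δ′) → Exhausts u → Exhausts v →
    ∀ (P : Pair Γ Δ) → Ω P → Ω (substPair u v P)

record Structure (L : Signature ℓ) : Set (lsuc ℓ) where
  open Signature L
  field
    Carrier   : Sort → Set ℓ
    inhabited : ∀ s → Carrier s
    fun       : (f : Fun) → All Carrier (dom f) → Carrier (cod f)
    rel       : (R : Rel) → All Carrier (arity R) → Set ℓ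

module Semantics {L : Signature ℓ} (M : Structure L) where
  open Signature L
  open Syntax L
  open Structure M renaming (rel to relᴹ)

  Tuple : Ctx → Set ℓ
  Tuple = All Carrier

  mutual
    eval : ∀ {Γ s} → Tuple Γ → Term Γ s → Carrier s
    eval a (var x)    = All.lookup a x
    eval a (app f ts) = fun f (evals a ts)

    evals : ∀ {Γ ss} → Tuple Γ → All (Term Γ) ss → All Carrier ss
    evals a []       = []
    evals a (t ∷ ts) = eval a t ∷ evals a ts

  Sat : ∀ {Γ} → Formula Γ → Tuple Γ → Set ℓ
  Sat ⊥̇          a = ⊥
  Sat (t ≈̇ t′)   a = eval a t ≡ eval a t′
  Sat (rel R ts) a = relᴹ R (evals a ts)
  Sat (¬̇ φ)      a = ¬ Sat φ a
  Sat (φ ∧̇ ψ)    a = Sat φ a × Sat ψ a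
  Sat (∃̇ s φ)    a = Σ[ m ∈ Carrier s ] Sat φ (m ∷ a)

  joinTuples : ∀ {Δ} k → (Fin k → Tuple Δ) → Tuple (copies k Δ)
  joinTuples zero    b = []
  joinTuples (suc k) b = Allₚ.++⁺ (b Fin.zero) (joinTuples k (b ∘ Fin.suc))

module Theories {L : Signature ℓ} where
  open Syntax L
  open Semantics using (Tuple; Sat; joinTuples)

  Theory : Set (lsuc ℓ)
  Theory = Pred Sentence ℓ

  _⊨ᵗ_ : Structure L → Theory → Set ℓ
  N ⊨ᵗ T = ∀ σ → T σ → Sat N σ []

  _⊨ˢ_ : Theory → Sentence → Set (lsuc ℓ)
  T ⊨ˢ σ = ∀ N → N ⊨ᵗ T → Sat N σ []

  Consistent : Theory → Set (lsuc ℓ)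
  Consistent T = ∃[ N ] N ⊨ᵗ T

  Complete : Theory → Set (lsuc ℓ)
  Complete T = ∀ σ → (T ⊨ˢ σ) ⊎ (T ⊨ˢ (¬̇ σ))

  -- (⋀ᵢ φ(x̄;ȳᵢ)) ∧ ψ(ȳ₀,…,ȳₖ₋₁) is not satisfiable in any model of T.
  IsInconsistencyWitness : Theory → ∀ {Γ Δ} k → Formula (Γ ++ Δ) → Formula (copies k Δ) → Set (lsuc ℓ)
  IsInconsistencyWitness T {Γ} {Δ} k φ ψ =
    ∀ N → N ⊨ᵗ T → (a : Tuple N Γ) (b : Fin k → Tuple N Δ) →
    ¬ ((∀ i → Sat N φ (Allₚ.++⁺ a (b i))) × Sat N ψ (joinTuples N k b))

  Ξ : Theory → PairSet (lsuc ℓ)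
  Ξ T (pair {k} φ ψ) = IsInconsistencyWitness T k φ ψ

-- |I| < |κ|; cardinals are represented by types.
_≺_ : Set ℓ → Set ℓ → Set ℓ
I ≺ κ = (I ↣ κ) × ¬ (κ ↣ I)

module Model {L : Signature ℓ} (M : Structure L) where
  open Signature L
  open Syntax L
  open Semantics M public
  open Structure M renaming (rel to relᴹ)

  Element : Set ℓ
  Element = Σ Sort Carrier

  Subset : Set (lsuc ℓ)
  Subset = Pred Element ℓ

  entries : ∀ {Γ} → Tuple Γ → Subset
  entries {Γ} a (s , m) = Σ[ i ∈ s ∈ Γ ] All.lookup a i ≡ m

  Finite : Subset → Set ℓ
  Finite A = ∃[ as ] A ≐ (_∈ as)

  Small : Set ℓ → Subset → Set (lsuc ℓ)
  Small κ A = Σ[ I ∈ Set ℓ ] (I ≺ κ) × Σ[ e ∈ I ↣ Element ]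
    (A ≐ λ m → ∃[ i ] Injection.to e i ≡ m)

  record Automorphism : Set ℓ where
    field
      bijection : ∀ s → Carrier s ↔ Carrier s

    to : ∀ {s} → Carrier s → Carrier s
    to {s} = Inverse.to (bijection s)

    field
      fun-pres : ∀ f a → to (fun f a) ≡ fun f (All.map to a)
      rel-pres : ∀ R a → relᴹ R a ⇔ relᴹ R (All.map to a)

    image : Subset → Subset
    image A (s , m) = Σ[ n ∈ Carrier s ] A (s , n) × to n ≡ m

  Conjugate : (A B C A′ B′ C′ : Subset) → Set ℓ
  Conjugate A B C A′ B′ C′ = Σ[ σ ∈ Automorphism ]
    let open Automorphism σ in (image A ≐ A′) × (image B ≐ B′) × (image C ≐ C′)

  -- A formula φ(x̄;b̄) with parameters b̄ from M, x̄ being of sorts Γ.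
  record FormulaWithParams (Γ : Ctx) : Set ℓ where
    constructor _⟨_⟩
    field
      {Δ}    : Ctx
      φ      : Formula (Γ ++ Δ)
      params : Tuple Δ
  open FormulaWithParams

  infix 4 _⊩_
  _⊩_ : ∀ {Γ} → Tuple Γ → FormulaWithParams Γ → Set ℓ
  a ⊩ χ = Sat (φ χ) (Allₚ.++⁺ a (params χ))

  PartialType : Ctx → Set (lsuc ℓ)
  PartialType Γ = Pred (FormulaWithParams Γ) ℓ

  _Realises_ : ∀ {Γ} → Tuple Γ → PartialType Γ → Set ℓ
  a Realises p = ∀ χ → p χ → a ⊩ χ

  _IsOver_ : ∀ {Γ} → PartialType Γ → Subset → Set ℓ
  p IsOver C = ∀ χ → p χ → entries (params χ) ⊆ C

  tp : ∀ {Γ} → Tuple Γ → Subset → PartialType Γ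
  tp a C χ = (entries (params χ) ⊆ C) × (a ⊩ χ)

  FinitelySatisfiable : ∀ {Γ} → PartialType Γ → Set ℓ
  FinitelySatisfiable p = ∀ χs → All p χs → ∃[ a ] All (a ⊩_) χs

  Saturated : Set ℓ → Set (lsuc ℓ)
  Saturated κ = ∀ C → Small κ C → ∀ s (p : PartialType (s ∷ [])) →
    p IsOver C → FinitelySatisfiable p → ∃[ a ] a Realises p

  -- Any two families indexed by a set of size < κ that satisfy the same
  -- formulas are conjugate under an automorphism.
  StronglyHomogeneous : Set ℓ → Set (lsuc ℓ)
  StronglyHomogeneous κ =
    ∀ (I : Set ℓ) → I ≺ κ → (sort : I → Sort) (a b : ∀ i → Carrier (sort i)) →
    (∀ (is : List I) (χ : Formula (map sort is)) →
       Sat χ (Allₚ.map⁺ (All.universal a is)) ⇔ Sat χ (Allₚ.map⁺ (All.universal b is))) →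
    Σ[ σ ∈ Automorphism ] ∀ i → Automorphism.to σ (a i) ≡ b i

  -- M is a big model with respect to the cardinal κ; "small" then means
  -- "of size < κ".  A saturated model of size κ > |L| is an instance.
  record IsBig (κ : Set ℓ) : Set (lsuc ℓ) where
    field
      language-small : Σ Ctx Formula ≺ κ
      saturated      : Saturated κ
      homogeneous    : StronglyHomogeneous κ

  -- φ(x̄;b̄) (φ,ψ)-divides over C.
  FormulaDivides : ∀ {Γ Δ} → Pair Γ Δ → Tuple Δ → Subset → Set ℓ
  FormulaDivides {Δ = Δ} (pair {k} _ ψ) b C =
    Σ[ bs ∈ (ℕ → Tuple Δ) ]
      (∀ i → bs i Realises tp b C) ×
      (∀ (ι : Fin k → ℕ) → (∀ {m n} → m Fin.< n → ι m < ι n) →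
         Sat ψ (joinTuples k (bs ∘ ι)))

  PairDivides : ∀ {Γ Δ} → Pair Γ Δ → PartialType Γ → Subset → Set ℓ
  PairDivides P p C = ∃[ b ] p (Pair.φ P ⟨ b ⟩) × FormulaDivides P b C

  Divides : PairSet ℓ → ∀ {Γ} → PartialType Γ → Subset → Set ℓ
  Divides Ω {Γ} p C = ∃[ Δ ] Σ[ P ∈ Pair Γ Δ ] Ω P × PairDivides P p C

  TernaryRelation : Set _
  TernaryRelation = (A C B : Subset) → Set ℓ

  -- Independent Ω A C B is A ⊥^Ω_C B: the base is the second argument.
  Independent : PairSet ℓ → TernaryRelation
  Independent Ω A C B =
    ¬ (Σ[ Γ ∈ Ctx ] Σ[ a ∈ Tuple Γ ] (entries a ⊆ A) × Divides Ω (tp a (B ∪ C)) C)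

  -- Subsets of small sets and finite sets are small, so smallness is only
  -- assumed of the largest sets involved.
  module Properties (κ : Set ℓ) (_⊥[_]_ : TernaryRelation) where

    Invariance : Set (lsuc ℓ)
    Invariance = ∀ {A B C A′ B′ C′} →
      Small κ A → Small κ B → Small κ C → Small κ A′ → Small κ B′ → Small κ C′ →
      A ⊥[ C ] B → Conjugate A′ B′ C′ A B C → A′ ⊥[ C′ ] B′

    Monotonicity : Set (lsuc ℓ)
    Monotonicity = ∀ {A B C A′ B′} → Small κ A → Small κ B → Small κ C →
      A ⊥[ C ] B → A′ ⊆ A → B′ ⊆ B → A′ ⊥[ C ] B′

    BaseMonotonicity : Set (lsuc ℓ)
    BaseMonotonicity = ∀ {A B C D} → Small κ A → Small κ B →
      D ⊆ C → C ⊆ B → A ⊥[ D ] B → A ⊥[ C ] B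

    FiniteCharacter : Set (lsuc ℓ)
    FiniteCharacter = ∀ {A B C} → Small κ A → Small κ B → Small κ C →
      (∀ A₀ → Finite A₀ → A₀ ⊆ A → A₀ ⊥[ C ] B) → A ⊥[ C ] B

    StrongFiniteCharacter : Set (lsuc ℓ)
    StrongFiniteCharacter = ∀ {A B C} → Small κ A → Small κ B → Small κ C →
      ¬ (A ⊥[ C ] B) →
      Σ[ Γ ∈ Ctx ] Σ[ Δ ∈ Ctx ] Σ[ E ∈ Ctx ]
      Σ[ a ∈ Tuple Γ ] Σ[ b ∈ Tuple Δ ] Σ[ c ∈ Tuple E ]
      Σ[ χ ∈ Formula (Γ ++ Δ ++ E) ]
        (entries a ⊆ A) × (entries b ⊆ B) × (entries c ⊆ C) ×
        Sat χ (Allₚ.++⁺ a (Allₚ.++⁺ b c)) ×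
        (∀ (a′ : Tuple Γ) → Sat χ (Allₚ.++⁺ a′ (Allₚ.++⁺ b c)) → ¬ (entries a′ ⊥[ C ] entries b))

{-# OPTIONS --safe #-}
module Submission where

open import Defs
open import Axiom.DoubleNegationElimination using (em⇒dne)
open import Axiom.ExcludedMiddle using (ExcludedMiddle)
import Data.Fin.Base as Fin
open import Data.List.Base using ([]; _∷_; _++_)
open import Data.List.Membership.Propositional using (_∈_)
open import Data.List.Membership.Propositional.Properties using (∈-++⁺ˡ; ∈-++⁺ʳ)
open import Data.List.Relation.Unary.All as All using (All; []; _∷_)
import Data.List.Relation.Unary.All.Properties as Allₚ
open import Data.List.Relation.Unary.Any using (here; there)
open import Data.Nat.Base using (zero; suc)
open import Data.Product.Base using (Σ-syntax; _×_; _,_; proj₁; proj₂)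
open import Data.Product.Function.NonDependent.Propositional using (_×-⇔_)
open import Data.Sum.Base using (inj₁; inj₂; [_,_])
open import Function.Base using (_∘_; id)
open import Function.Bundles using (_⇔_; Equivalence; Inverse; Injection; mk⇔)
open import Function.Construct.Identity using (⇔-id)
open import Function.Properties.Inverse using (↔⇒↣)
open import Function.Related.TypeIsomorphisms using (¬-cong-⇔)
open import Relation.Binary.PropositionalEquality
  using (_≡_; refl; sym; trans; cong; cong₂; subst; module ≡-Reasoning)
open import Relation.Unary using (Pred; _⊆_; _∪_; _≐_)

-- A failure of independence of A from B over C has a finite witness: a tuple a in A, parameters b
-- in B ∪ C, and a pair (φ,ψ) in Ω such that φ(a;b) holds and φ(x;b) divides over C. The structural
-- properties transport such a witness. Automorphisms preserve truth, hence types and dividing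
-- (`FormulaDivides-map-to`); enlarging A or B keeps the witness; shrinking the base keeps it too,
-- since conjugates of b over C are conjugates over any subset (`FormulaDivides-antitone`). Dividing
-- of φ(x;b) does not mention a, so every a′ satisfying φ(x;b) is a witness as well, which gives
-- strong finite character.
--
-- For the last two claims, suppose φ(x;b) divides along (bᵢ). If b lies in the base, then bᵢ = b
-- for all i (`tp-≡`); if a lies in the base, then φ(a;y) belongs to the type of b (`tp-swap`).
-- Either way a satisfies every φ(x;bᵢ) while ψ holds of the first k terms, which contradicts that ψ
-- is an inconsistency witness.

module _ {a p} {A : Set a} {P : Pred A p} where

  lookup-++⁺ˡ : ∀ {x xs ys} (ps : All P xs) (qs : All P ys) (i : x ∈ xs) →
    All.lookup (Allₚ.++⁺ ps qs) (∈-++⁺ˡ i) ≡ All.lookup ps i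
  lookup-++⁺ˡ (p ∷ ps) qs (here refl) = refl
  lookup-++⁺ˡ (p ∷ ps) qs (there i)   = lookup-++⁺ˡ ps qs i

  lookup-++⁺ʳ : ∀ {x xs ys} (ps : All P xs) (qs : All P ys) (i : x ∈ ys) →
    All.lookup (Allₚ.++⁺ ps qs) (∈-++⁺ʳ xs i) ≡ All.lookup qs i
  lookup-++⁺ʳ []       qs i = refl
  lookup-++⁺ʳ (p ∷ ps) qs i = lookup-++⁺ʳ ps qs i

  lookup-ext : ∀ {xs} {ps qs : All P xs} →
    (∀ {x} (i : x ∈ xs) → All.lookup ps i ≡ All.lookup qs i) → ps ≡ qs
  lookup-ext {ps = []}     {[]}     eq = refl
  lookup-ext {ps = p ∷ ps} {q ∷ qs} eq = cong₂ _∷_ (eq (here refl)) (lookup-ext (eq ∘ there))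

  map-++⁺ : ∀ {q} {Q : Pred A q} (f : P ⊆ Q) {xs ys} (ps : All P xs) (qs : All P ys) →
    All.map f (Allₚ.++⁺ ps qs) ≡ Allₚ.++⁺ (All.map f ps) (All.map f qs)
  map-++⁺ f []       qs = refl
  map-++⁺ f (p ∷ ps) qs = cong (f p ∷_) (map-++⁺ f ps qs)

module _ {ℓ} {L : Signature ℓ} (M : Structure L) where
  open Syntax L
  open Structure M renaming (rel to relᴹ)
  open Model M

  -- Renaming of variables and satisfaction

  pullback : ∀ {Γ Γ′} → Vars Γ Γ′ → Tuple Γ′ → Tuple Γ
  pullback u a = All.map (All.lookup a) u

  pullback-lift : ∀ {Γ Γ′ s} (u : Vars Γ Γ′) (m : Carrier s) (a : Tuple Γ′) →
    pullback (lift u) (m ∷ a) ≡ m ∷ pullback u a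
  pullback-lift u m a = cong (m ∷_) (Allₚ.map-∘ u)

  pullback-tabulate : ∀ {Γ Γ′} (f : ∀ {s} → s ∈ Γ → s ∈ Γ′) (a : Tuple Γ′) (b : Tuple Γ) →
    (∀ {s} (i : s ∈ Γ) → All.lookup a (f i) ≡ All.lookup b i) → pullback (All.tabulate f) a ≡ b
  pullback-tabulate f a []      eq = refl
  pullback-tabulate f a (m ∷ b) eq =
    cong₂ _∷_ (eq (here refl)) (pullback-tabulate (f ∘ there) a b (eq ∘ there))

  pullback-⊕ : ∀ {Γ Γ′ Δ Δ′} (u : Vars Γ Γ′) (v : Vars Δ Δ′) (a : Tuple Γ′) (b : Tuple Δ′) →
    pullback (u ⊕ v) (Allₚ.++⁺ a b) ≡ Allₚ.++⁺ (pullback u a) (pullback v b)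
  pullback-⊕ u v a b = trans (map-++⁺ _ (All.map ∈-++⁺ˡ u) _) (cong₂ Allₚ.++⁺
    (trans (Allₚ.map-∘ u) (Allₚ.map-cong u (lookup-++⁺ˡ a b)))
    (trans (Allₚ.map-∘ v) (Allₚ.map-cong v (lookup-++⁺ʳ a b))))

  module _ {Γ Γ′} (u : Vars Γ Γ′) (a : Tuple Γ′) where mutual

    eval-rename : ∀ {s} (t : Term Γ s) → eval a (renameTerm u t) ≡ eval (pullback u a) t
    eval-rename (var i)    = sym (Allₚ.lookup-map u i)
    eval-rename (app f ts) = cong (fun f) (evals-rename ts)

    evals-rename : ∀ {ss} (ts : All (Term Γ) ss) →
      evals a (renameTerms u ts) ≡ evals (pullback u a) ts
    evals-rename []       = refl
    evals-rename (t ∷ ts) = cong₂ _∷_ (eval-rename t) (evals-rename ts)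

  -- The substitution lemma: to exchange or split blocks of variables in a formula, it then suffices
  -- to compute one pullback of tuples.
  Sat-rename : ∀ {Γ Γ′} (u : Vars Γ Γ′) (a : Tuple Γ′) (φ : Formula Γ) →
    Sat (rename u φ) a ⇔ Sat φ (pullback u a)
  Sat-rename u a ⊥̇ = ⇔-id _
  Sat-rename u a (t ≈̇ t′) rewrite eval-rename u a t | eval-rename u a t′ = ⇔-id _
  Sat-rename u a (rel R ts) rewrite evals-rename u a ts = ⇔-id _
  Sat-rename u a (¬̇ φ) = ¬-cong-⇔ (Sat-rename u a φ)
  Sat-rename u a (φ ∧̇ ψ) = Sat-rename u a φ ×-⇔ Sat-rename u a ψ
  Sat-rename u a (∃̇ s φ) = mk⇔
    (λ (m , sat) → m , subst (Sat φ) (pullback-lift u m a)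
      (Equivalence.to (Sat-rename (lift u) (m ∷ a) φ) sat))
    (λ (m , sat) → m , Equivalence.from (Sat-rename (lift u) (m ∷ a) φ)
      (subst (Sat φ) (sym (pullback-lift u m a)) sat))

  -- Entries of tuples

  entries-toList : ∀ {Γ} (a : Tuple Γ) → entries a ≐ (_∈ All.toList a)
  entries-toList a = to a , from a
    where
    to : ∀ {Γ} (a : Tuple Γ) → entries a ⊆ (_∈ All.toList a)
    to (m ∷ a) (here refl , refl) = here refl
    to (m ∷ a) (there i , eq)     = there (to a (i , eq))

    from : ∀ {Γ} (a : Tuple Γ) → (_∈ All.toList a) ⊆ entries a
    from (m ∷ a) (here refl) = here refl , refl
    from (m ∷ a) (there p)   = let i , eq = from a p in there i , eq

  entries-++⁺ : ∀ {Γ Δ} (a : Tuple Γ) (b : Tuple Δ) →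
    entries a ∪ entries b ⊆ entries (Allₚ.++⁺ a b)
  entries-++⁺ a b (inj₁ (i , eq)) = ∈-++⁺ˡ i , trans (lookup-++⁺ˡ a b i) eq
  entries-++⁺ {Γ} a b (inj₂ (i , eq)) = ∈-++⁺ʳ Γ i , trans (lookup-++⁺ʳ a b i) eq

  -- Parameters from B ∪ C come interleaved, whereas strong finite character wants one tuple from
  -- each set. Covering the entries is enough, because `entries-pullback` restores their order.
  entries-split : ∀ {A B : Subset} {Γ} (a : Tuple Γ) → entries a ⊆ A ∪ B →
    Σ[ Δ ∈ Ctx ] Σ[ E ∈ Ctx ] Σ[ b ∈ Tuple Δ ] Σ[ c ∈ Tuple E ]
      (entries b ⊆ A) × (entries c ⊆ B) × (entries a ⊆ entries b ∪ entries c)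
  entries-split [] a⊆ = [] , [] , [] , [] , (λ ()) , (λ ()) , λ ()
  entries-split (m ∷ a) a⊆
    with entries-split a (λ (i , eq) → a⊆ (there i , eq)) | a⊆ (here refl , refl)
  ... | Δ , E , b , c , b⊆ , c⊆ , cover | inj₁ m∈A =
    _ , E , m ∷ b , c
    , (λ { (here refl , refl) → m∈A ; (there i , eq) → b⊆ (i , eq) })
    , c⊆
    , λ { (here refl , refl) → inj₁ (here refl , refl)
        ; (there i , eq) → [ (λ (j , eq′) → inj₁ (there j , eq′)) , inj₂ ] (cover (i , eq)) }
  ... | Δ , E , b , c , b⊆ , c⊆ , cover | inj₂ m∈B =
    Δ , _ , b , m ∷ c
    , b⊆
    , (λ { (here refl , refl) → m∈B ; (there i , eq) → c⊆ (i , eq) })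
    , λ { (here refl , refl) → inj₂ (here refl , refl)
        ; (there i , eq) → [ inj₁ , (λ (j , eq′) → inj₂ (there j , eq′)) ] (cover (i , eq)) }

  -- Each entry of `a` selects a position of `b` holding the same element; reorderings and
  -- repetitions are absorbed by the tuple of variables.
  entries-pullback : ∀ {Γ Δ} (a : Tuple Γ) (b : Tuple Δ) → entries a ⊆ entries b →
    Σ[ u ∈ Vars Γ Δ ] pullback u b ≡ a
  entries-pullback a b a⊆b =
    All.tabulate (λ i → proj₁ (a⊆b (i , refl)))
    , pullback-tabulate _ b a (λ i → proj₂ (a⊆b (i , refl)))

  -- Types over a set

  tp-≡ : ∀ {Γ} (a b : Tuple Γ) (C : Subset) → entries b ⊆ C → a Realises tp b C → a ≡ b
  tp-≡ {Γ} a b C b⊆C a⊨ = lookup-ext λ i → begin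
    All.lookup a i                             ≡⟨ lookup-++⁺ˡ a b i ⟨
    -- The formula xᵢ = yᵢ with `b` itself as parameters is over `C` and true of `b`, so it belongs
    -- to the type.
    All.lookup (Allₚ.++⁺ a b) (∈-++⁺ˡ i)       ≡⟨ a⊨ (eqᵢ i ⟨ b ⟩) (b⊆C , b⊩ i) ⟩
    All.lookup (Allₚ.++⁺ a b) (∈-++⁺ʳ Γ i)     ≡⟨ lookup-++⁺ʳ a b i ⟩
    All.lookup b i                             ∎
    where
    open ≡-Reasoning
    eqᵢ : ∀ {s} → s ∈ Γ → Formula (Γ ++ Γ)
    eqᵢ i = var (∈-++⁺ˡ i) ≈̇ var (∈-++⁺ʳ Γ i)
    b⊩ : ∀ {s} (i : s ∈ Γ) → b ⊩ (eqᵢ i ⟨ b ⟩)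
    b⊩ i = trans (lookup-++⁺ˡ b b i) (sym (lookup-++⁺ʳ b b i))

  -- φ(x̄;ȳ) with its blocks exchanged is a formula over ā in the type of b̄.
  tp-swap : ∀ {Γ Δ} (φ : Formula (Γ ++ Δ)) (a : Tuple Γ) (b b′ : Tuple Δ) (C : Subset) →
    entries a ⊆ C → b′ Realises tp b C → Sat φ (Allₚ.++⁺ a b) → Sat φ (Allₚ.++⁺ a b′)
  tp-swap {Γ} {Δ} φ a b b′ C a⊆C b′⊨ sat =
    to b′ (b′⊨ (rename swap φ ⟨ a ⟩) (a⊆C , from b sat))
    where
    swapˡ : Vars Γ (Δ ++ Γ)
    swapˡ = All.tabulate (∈-++⁺ʳ Δ)
    swapʳ : Vars Δ (Δ ++ Γ)
    swapʳ = All.tabulate ∈-++⁺ˡ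
    swap : Vars (Γ ++ Δ) (Δ ++ Γ)
    swap = Allₚ.++⁺ swapˡ swapʳ
    pullback-swap : ∀ d → pullback swap (Allₚ.++⁺ d a) ≡ Allₚ.++⁺ a d
    pullback-swap d = trans (map-++⁺ _ swapˡ swapʳ) (cong₂ Allₚ.++⁺
      (pullback-tabulate _ (Allₚ.++⁺ d a) a (lookup-++⁺ʳ d a))
      (pullback-tabulate _ (Allₚ.++⁺ d a) d (lookup-++⁺ˡ d a)))
    to : ∀ d → Sat (rename swap φ) (Allₚ.++⁺ d a) → Sat φ (Allₚ.++⁺ a d)
    to d = subst (Sat φ) (pullback-swap d) ∘ Equivalence.to (Sat-rename swap _ φ)
    from : ∀ d → Sat φ (Allₚ.++⁺ a d) → Sat (rename swap φ) (Allₚ.++⁺ d a)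
    from d = Equivalence.from (Sat-rename swap _ φ) ∘ subst (Sat φ) (sym (pullback-swap d))

  Realises-antitone : ∀ {Γ} {a b : Tuple Γ} {C D : Subset} → D ⊆ C →
    a Realises tp b C → a Realises tp b D
  Realises-antitone D⊆C a⊨ χ (χ⊆D , b⊩χ) = a⊨ χ (D⊆C ∘ χ⊆D , b⊩χ)

  -- Automorphisms preserve truth, types and dividing

  module _ (σ : Automorphism) where
    open Automorphism σ

    to-injective : ∀ {s} {m n : Carrier s} → to m ≡ to n → m ≡ n
    to-injective {s} = Injection.injective (↔⇒↣ (bijection s))

    mutual
      eval-map-to : ∀ {Γ s} (a : Tuple Γ) (t : Term Γ s) → eval (All.map to a) t ≡ to (eval a t)
      eval-map-to a (var i)    = Allₚ.lookup-map a i
      eval-map-to a (app f ts) = trans (cong (fun f) (evals-map-to a ts)) (sym (fun-pres f _))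

      evals-map-to : ∀ {Γ ss} (a : Tuple Γ) (ts : All (Term Γ) ss) →
        evals (All.map to a) ts ≡ All.map to (evals a ts)
      evals-map-to a []       = refl
      evals-map-to a (t ∷ ts) = cong₂ _∷_ (eval-map-to a t) (evals-map-to a ts)

    Sat-map-to : ∀ {Γ} (φ : Formula Γ) (a : Tuple Γ) → Sat φ a ⇔ Sat φ (All.map to a)
    Sat-map-to ⊥̇ a = ⇔-id _
    Sat-map-to (t ≈̇ t′) a rewrite eval-map-to a t | eval-map-to a t′ = mk⇔ (cong to) to-injective
    Sat-map-to (rel R ts) a rewrite evals-map-to a ts = rel-pres R (evals a ts)
    Sat-map-to (¬̇ φ) a = ¬-cong-⇔ (Sat-map-to φ a)
    Sat-map-to (φ ∧̇ ψ) a = Sat-map-to φ a ×-⇔ Sat-map-to ψ a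
    Sat-map-to (∃̇ s φ) a = mk⇔
      (λ (m , sat) → to m , Equivalence.to (Sat-map-to φ (m ∷ a)) sat)
      -- Surjectivity of the automorphism: the witness is pulled back along its inverse.
      (λ (m , sat) → Inverse.from (bijection s) m
        , Equivalence.from (Sat-map-to φ _)
            (subst (λ n → Sat φ (n ∷ _)) (sym (Inverse.strictlyInverseˡ (bijection s) m)) sat))

    Sat-++⁺-map-to : ∀ {Γ Δ} (φ : Formula (Γ ++ Δ)) (a : Tuple Γ) (b : Tuple Δ) →
      Sat φ (Allₚ.++⁺ a b) ⇔ Sat φ (Allₚ.++⁺ (All.map to a) (All.map to b))
    Sat-++⁺-map-to φ a b =
      subst (λ d → _ ⇔ Sat φ d) (map-++⁺ to a b) (Sat-map-to φ (Allₚ.++⁺ a b))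

    joinTuples-map-to : ∀ {Δ} k (b : Fin.Fin k → Tuple Δ) →
      joinTuples k (All.map to ∘ b) ≡ All.map to (joinTuples k b)
    joinTuples-map-to zero    b = refl
    joinTuples-map-to (suc k) b = trans
      (cong (Allₚ.++⁺ _) (joinTuples-map-to k (b ∘ Fin.suc))) (sym (map-++⁺ to (b Fin.zero) _))

    entries-map-to : ∀ {Γ} (a : Tuple Γ) {A : Subset} → entries a ⊆ A →
      entries (All.map to a) ⊆ image A
    entries-map-to a a⊆A (i , refl) =
      All.lookup a i , a⊆A (i , refl) , sym (Allₚ.lookup-map a i)

    entries⊆image : ∀ {Γ} (a : Tuple Γ) {A : Subset} → entries a ⊆ image A →
      Σ[ b ∈ Tuple Γ ] (entries b ⊆ A) × All.map to b ≡ a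
    entries⊆image [] a⊆ = [] , (λ ()) , refl
    entries⊆image (m ∷ a) a⊆
      with entries⊆image a (λ (i , eq) → a⊆ (there i , eq)) | a⊆ (here refl , refl)
    ... | b , b⊆ , refl | n , n∈A , refl =
      n ∷ b , (λ { (here refl , refl) → n∈A ; (there i , eq) → b⊆ (i , eq) }) , refl

    -- Parameters from `image C` have preimages in `C`, so a formula over `image C` can be moved
    -- back over `C`, transferred there, and moved forward again.
    Realises-map-to : ∀ {Γ} (a b : Tuple Γ) (C : Subset) → a Realises tp b C →
      All.map to a Realises tp (All.map to b) (image C)
    Realises-map-to a b C a⊨ (φ ⟨ d ⟩) (d⊆ , sat) with entries⊆image d d⊆
    ... | c , c⊆C , refl = Equivalence.to (Sat-++⁺-map-to φ a c)
      (a⊨ (φ ⟨ c ⟩) (c⊆C , Equivalence.from (Sat-++⁺-map-to φ b c) sat))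

    FormulaDivides-map-to : ∀ {Γ Δ} (P : Pair Γ Δ) (b : Tuple Δ) (C : Subset) →
      FormulaDivides P b C → FormulaDivides P (All.map to b) (image C)
    FormulaDivides-map-to (pair {k} _ ψ) b C (bs , bs⊨ , ψ-holds) =
      All.map to ∘ bs
      , (λ i → Realises-map-to (bs i) b C (bs⊨ i))
      , λ ι ι-mono → subst (Sat ψ) (sym (joinTuples-map-to k (bs ∘ ι)))
          (Equivalence.to (Sat-map-to ψ _) (ψ-holds ι ι-mono))

  FormulaDivides-antitone : ∀ {Γ Δ} (P : Pair Γ Δ) {b : Tuple Δ} {C D : Subset} → D ⊆ C →
    FormulaDivides P b C → FormulaDivides P b D
  FormulaDivides-antitone P D⊆C (bs , bs⊨ , ψ-holds) =
    bs , (λ i → Realises-antitone D⊆C (bs⊨ i)) , ψ-holds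

  -- Properties of the independence relation

  module _ (κ : Set ℓ) (Ω : PairSet ℓ) where
    open Properties κ (Independent Ω)

    invariance : Invariance
    invariance _ _ _ _ _ _ A⊥B (σ , A′≐A , B′≐B , C′≐C)
      (Γ , a , a⊆A′ , Δ , P , P∈Ω , b , (b⊆B′C′ , sat) , divides) =
      A⊥B
        ( Γ , All.map to a , proj₁ A′≐A ∘ entries-map-to σ a a⊆A′
        , Δ , P , P∈Ω , All.map to b
        , (image-∪ ∘ entries-map-to σ b b⊆B′C′ , Equivalence.to (Sat-++⁺-map-to σ (Pair.φ P) a b) sat)
        -- Dividing over `image C′` passes down to `C` along the inclusion of `C` in `image C′`.
        , FormulaDivides-antitone P (proj₂ C′≐C) (FormulaDivides-map-to σ P b _ divides))
      where
      open Automorphism σ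
      image-∪ : image _ ⊆ _
      image-∪ (n , inj₁ n∈B′ , eq) = inj₁ (proj₁ B′≐B (n , n∈B′ , eq))
      image-∪ (n , inj₂ n∈C′ , eq) = inj₂ (proj₁ C′≐C (n , n∈C′ , eq))

    monotonicity : Monotonicity
    monotonicity _ _ _ A⊥B A′⊆A B′⊆B (Γ , a , a⊆A′ , Δ , P , P∈Ω , b , (b⊆B′C , sat) , divides) =
      A⊥B ( Γ , a , A′⊆A ∘ a⊆A′ , Δ , P , P∈Ω , b
          , ([ inj₁ ∘ B′⊆B , inj₂ ] ∘ b⊆B′C , sat) , divides)

    baseMonotonicity : BaseMonotonicity
    baseMonotonicity _ _ D⊆C C⊆B A⊥B (Γ , a , a⊆A , Δ , P , P∈Ω , b , (b⊆BC , sat) , divides) =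
      A⊥B ( Γ , a , a⊆A , Δ , P , P∈Ω , b
          -- As C ⊆ B, the parameters already lie in B, hence in B ∪ D.
          , ([ inj₁ , inj₁ ∘ C⊆B ] ∘ b⊆BC , sat) , FormulaDivides-antitone P D⊆C divides)

    finiteCharacter : FiniteCharacter
    finiteCharacter _ _ _ A₀⊥B (Γ , a , a⊆A , divides) =
      A₀⊥B (entries a) (All.toList a , entries-toList a) a⊆A (Γ , a , id , divides)

    -- The formula is φ(x̄;b̄) itself, with b̄ rearranged into its part in B and its part in C.
    strongFiniteCharacter : ExcludedMiddle ℓ → StrongFiniteCharacter
    strongFiniteCharacter em {A} {B} {C} _ _ _ A⊥̸B
      -- Independence is a negation, so a witness of its failure is extracted classically.
      with em⇒dne em A⊥̸B
    ... | Γ , a , a⊆A , Δ , P , P∈Ω , b , (b⊆BC , sat) , divides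
      with entries-split b b⊆BC
    ... | Δ₀ , E , b₀ , c , b₀⊆B , c⊆C , cover
      with entries-pullback b (Allₚ.++⁺ b₀ c) (entries-++⁺ b₀ c ∘ cover)
    ... | v , pullback-v =
      Γ , Δ₀ , E , a , b₀ , c , rename u φ , a⊆A , b₀⊆B , c⊆C
      , Equivalence.from (Sat-rename u _ φ) (subst (Sat φ) (sym (pullback-u a)) sat)
      -- The dividing sequence depends on `b` and `C` alone, so it serves for every `a′`.
      , λ a′ sat′ a′⊥b₀ → a′⊥b₀
          ( Γ , a′ , id , Δ , P , P∈Ω , b
          , ( [ inj₁ , inj₂ ∘ c⊆C ] ∘ cover
            , subst (Sat φ) (pullback-u a′) (Equivalence.to (Sat-rename u _ φ) sat′))
          , divides)
      where
      φ : Formula (Γ ++ Δ)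
      φ = Pair.φ P
      idVars : Vars Γ Γ
      idVars = All.tabulate id
      u : Vars (Γ ++ Δ) (Γ ++ Δ₀ ++ E)
      u = idVars ⊕ v
      pullback-u : ∀ a′ → pullback u (Allₚ.++⁺ a′ (Allₚ.++⁺ b₀ c)) ≡ Allₚ.++⁺ a′ b
      pullback-u a′ = trans (pullback-⊕ idVars v a′ _)
        (cong₂ Allₚ.++⁺ (pullback-tabulate id a′ a′ (λ _ → refl)) pullback-v)

    -- Independence when one side is the base

    module _ {T : Theories.Theory} (M⊨T : Theories._⊨ᵗ_ M T)
      (Ω⊆Ξ : ∀ {Γ Δ} → Ω {Γ} {Δ} ⊆ Theories.Ξ T) where

      -- If each b̄ᵢ of the dividing sequence inherits φ(ā;b̄ᵢ) from φ(ā;b̄), then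
      -- b̄₀, …, b̄ₖ₋₁ and ā refute that ψ is an inconsistency witness for φ.
      independent-if-shared : ∀ (A B C : Subset) →
        (∀ {Γ Δ} (φ : Formula (Γ ++ Δ)) (a : Tuple Γ) (b b′ : Tuple Δ) →
           entries a ⊆ A → entries b ⊆ B ∪ C → b′ Realises tp b C →
           Sat φ (Allₚ.++⁺ a b) → Sat φ (Allₚ.++⁺ a b′)) →
        Independent Ω A C B
      independent-if-shared A B C shared
        (Γ , a , a⊆A , Δ , P , P∈Ω , b , (b⊆BC , sat) , bs , bs⊨ , ψ-holds) =
        Ω⊆Ξ P∈Ω M M⊨T a (bs ∘ Fin.toℕ)
          ( (λ i → shared (Pair.φ P) a b (bs (Fin.toℕ i)) a⊆A b⊆BC (bs⊨ (Fin.toℕ i)) sat)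
          , ψ-holds Fin.toℕ id)

      -- Here `b` lies in the base, so its type over the base forces each term of the sequence to
      -- equal `b`.
      independent-base-right : ∀ (A B : Subset) → Independent Ω A B B
      independent-base-right A B = independent-if-shared A B B λ φ a b b′ _ b⊆BB b′⊨ →
        subst (λ d → Sat φ (Allₚ.++⁺ a d)) (sym (tp-≡ b′ b B ([ id , id ] ∘ b⊆BB) b′⊨))

      -- Here `a` lies in the base, so φ(a;y) is part of the type that each term of the sequence
      -- realises.
      independent-base-left : ∀ (A B : Subset) → Independent Ω A A B
      independent-base-left A B = independent-if-shared A B A λ φ a b b′ a⊆A _ b′⊨ →
        tp-swap φ a b b′ A a⊆A b′⊨

proposition2p12 :
    ∀ {ℓ} → ExcludedMiddle ℓ →
    (L : Signature ℓ) →
    let open Syntax L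
        open Theories {L = L} in
    (T : Theory) → Complete T → Consistent T →
    (κ : Set ℓ) (M : Structure L) → M ⊨ᵗ T →
    let open Model M in
    IsBig κ →
    (Ω : PairSet ℓ) → (∀ {Γ Δ} → Ω {Γ} {Δ} ⊆ Ξ T) → ClosedUnderVariableSubstitution Ω →
    let open Properties κ (Independent Ω) in
    Invariance × Monotonicity × BaseMonotonicity × FiniteCharacter
    × StrongFiniteCharacter
    × (∀ (A B : Subset) → Small κ A → Small κ B → Independent Ω A B B)
    × (∀ (A B : Subset) → Small κ A → Small κ B → Independent Ω A A B)
proposition2p12 em L T _ _ κ M M⊨T _ Ω Ω⊆Ξ _ =
  invariance M κ Ω , monotonicity M κ Ω , baseMonotonicity M κ Ω , finiteCharacter M κ Ω
  , strongFiniteCharacter M κ Ω em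
  , (λ A B _ _ → independent-base-right M κ Ω M⊨T Ω⊆Ξ A B)
  , (λ A B _ _ → independent-base-left M κ Ω M⊨T Ω⊆Ξ A B)
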